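{- Let $G$ be a simple connected signed graph with maximum degree $\Delta(G)$. If $G$ is not a balanced complete graph, a balanced odd circuit, or an unbalanced even circuit, then $\chi(G)\le\Delta(G)$.
   Context: All graphs are finite and nonempty. A signed graph $G$ is a graph in which each edge $e$ is labelled with a sign $\sigma(e)\in\{+1,-1\}$; it is simple if its underlying unsigned graph has no loops and no parallel edges. Graph-theoretic terms such as connected, maximum degree, complete graph and circuit refer to the underlying unsigned graph; a circuit (cycle graph) is odd or even according to its length. A signed graph is balanced if the product of the edge signs on each of its circuits is $+1$, and unbalanced otherwise. A proper colouring of $G$ is a mapping $\phi\colon V(G)\to\mathbb{Z}$ such that for each edge $e=uv$ of $G$ we have $\phi(u)\neq\sigma(e)\phi(v)$. For $n\ge1$ let $M_n=\{\pm1,\pm2,\ldots,\pm k\}$ if $n=2k$, and $M_n=\{0,\pm1,\pm2,\ldots,\pm k\}$ if $n=2k+1$. An $n$-colouring of $G$ is a proper colouring of $G$ using colours from $M_n$. The chromatic number $\chi(G)$ of a signed graph $G$ is the smallest $n\ge 1$ such that $G$ admits an $n$-colouring. -}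

module Defs where

open import Data.Fin as Fin using (Fin; zero; suc; toℕ)
open import Data.Fin.Properties as Fin using (all?; toℕ-injective)
open import Data.Integer as ℤ using (ℤ; +_; -[1+_]; ∣_∣; _◃_)
import Data.Integer.Properties as ℤ
open import Data.List as List using (List; []; _∷_; _++_; length; map; filter; allFin; upTo)
open import Data.List.Extrema.Nat using (max)
open import Data.List.Membership.Propositional using (_∈_; find; lose)
open import Data.List.Membership.Propositional.Properties using (∈-map⁺; ∈-++⁺ˡ; ∈-++⁺ʳ; ∈-upTo⁺)
import Data.List.Relation.Unary.Any as Any
open import Data.List.Relation.Unary.Unique.Propositional using (Unique)
open import Data.Maybe using (Maybe; just; nothing)
open import Data.Nat as ℕ using (ℕ; zero; suc; _≤_; _<_; z≤n; s≤s; NonZero)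
open import Data.Nat.Divisibility using (_∣_)
import Data.Nat.Properties as ℕ
open import Data.Product using (∃; _×_; _,_; proj₁; proj₂)
open import Data.Sign as Sign using (Sign)
open import Data.Sum using (_⊎_; inj₁; inj₂)
import Data.Vec.Functional as Vector
open import Function using (_∘_)
open import Relation.Binary.Construct.Closure.ReflexiveTransitive using (Star; ε; _◅_)
open import Relation.Binary.PropositionalEquality
  using (_≡_; _≢_; _≗_; refl; sym; trans; cong; subst; subst₂)
open import Relation.Nullary using (¬_; Dec; yes; no; contradiction)
open import Relation.Nullary.Decidable using (map′; _×-dec_; _⊎-dec_; ¬?)
open import Relation.Unary using (Pred; Decidable)
open import Level using (0ℓ)

-- `label u v` is `just s` when uv is an edge of sign s, and `nothing`
-- when u and v are not adjacent.
record SimpleSignedGraph : Set where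
  field
    order        : ℕ
    .{{nonEmpty}} : NonZero order
    label        : Fin order → Fin order → Maybe Sign
    label-sym    : ∀ u v → label u v ≡ label v u
    label-irrefl : ∀ v → label v v ≡ nothing

  V : Set
  V = Fin order

  Adjacent : V → V → Set
  Adjacent u v = ∃ λ s → label u v ≡ just s

  adjacent? : ∀ u → Decidable (Adjacent u)
  adjacent? u v with label u v
  ... | just s  = yes (s , refl)
  ... | nothing = no λ ()

  degree : V → ℕ
  degree v = length (filter (adjacent? v) (allFin order))

  Δ : ℕ
  Δ = max 0 (map degree (allFin order))

  Walk : V → V → Set
  Walk = Star Adjacent

  Connected : Set
  Connected = ∀ u v → Walk u v

  Complete : Set
  Complete = ∀ u v → u ≢ v → Adjacent u v

  steps : ∀ {u v} → Walk u v → List (V × V)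
  steps ε                         = []
  steps (_◅_ {i = u} {j = v} _ w) = (u , v) ∷ steps w

  signs : ∀ {u v} → Walk u v → List Sign
  signs ε             = []
  signs ((s , _) ◅ w) = s ∷ signs w

  -- Recording the initial vertex of each step lists the vertices of a
  -- closed walk once around.  In a simple graph, a closed walk with at
  -- least three steps is a circuit iff these vertices are distinct.
  record Circuit : Set where
    field
      {base}   : V
      walk     : Walk base base

    edges : List (V × V)
    edges = steps walk

    vertices : List V
    vertices = map proj₁ edges

    size : ℕ
    size = length edges

    sign : Sign
    sign = List.foldr Sign._*_ Sign.+ (signs walk)

    field
      3≤size   : 3 ≤ size
      distinct : Unique vertices

  open Circuit public using (edges; vertices; size; sign)

  Balanced : Set
  Balanced = ∀ (C : Circuit) → sign C ≡ Sign.+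

  -- The whole graph is the circuit C.  Edges are undirected, whereas
  -- `edges C` is oriented along C.
  _IsWholeGraph : Circuit → Set
  C IsWholeGraph =
    (∀ v → v ∈ vertices C) ×
    (∀ u v → Adjacent u v → (u , v) ∈ edges C ⊎ (v , u) ∈ edges C)

  IsOddCircuit : Set
  IsOddCircuit = ∃ λ C → C IsWholeGraph × ¬ 2 ∣ size C

  IsEvenCircuit : Set
  IsEvenCircuit = ∃ λ C → C IsWholeGraph × 2 ∣ size C

M : ℕ → Pred ℤ 0ℓ
M n z = ∃ λ k → (n ≡ 2 ℕ.* k × 1 ≤ ∣ z ∣ × ∣ z ∣ ≤ k)
              ⊎ (n ≡ 2 ℕ.* k ℕ.+ 1 × ∣ z ∣ ≤ k)

module _ (G : SimpleSignedGraph) where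
  open SimpleSignedGraph G

  -- `s ◃ 1` is the sign s as the integer ±1.
  Proper : (V → ℤ) → Set
  Proper φ = ∀ u v s → label u v ≡ just s → φ u ≢ (s ◃ 1) ℤ.* φ v

  Colouring : ℕ → (V → ℤ) → Set
  Colouring n φ = (∀ v → M n (φ v)) × Proper φ

  Colourable : ℕ → Set
  Colourable n = ∃ (Colouring n)

  IsChromaticNumber : ℕ → Set
  IsChromaticNumber n =
    1 ≤ n × Colourable n × (∀ m → 1 ≤ m → Colourable m → n ≤ m)

M⇒∣∣≤ : ∀ n {z} → M n z → ∣ z ∣ ≤ n
M⇒∣∣≤ _ (k , inj₁ (refl , _ , z≤k)) = ℕ.≤-trans z≤k (ℕ.m≤m+n k _)
M⇒∣∣≤ _ (k , inj₂ (refl , z≤k)) =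
  ℕ.≤-trans z≤k (ℕ.≤-trans (ℕ.m≤m+n k _) (ℕ.m≤m+n _ 1))

M? : ∀ n → Decidable (M n)
M? n z = map′ (λ (k , _ , p) → k , p) bound (ℕ.anyUpTo? body? (suc n))
  where
  Body : ℕ → Set
  Body k = (n ≡ 2 ℕ.* k × 1 ≤ ∣ z ∣ × ∣ z ∣ ≤ k)
         ⊎ (n ≡ 2 ℕ.* k ℕ.+ 1 × ∣ z ∣ ≤ k)

  body? : Decidable Body
  body? k = ((n ℕ.≟ 2 ℕ.* k) ×-dec (1 ℕ.≤? ∣ z ∣) ×-dec (∣ z ∣ ℕ.≤? k))
      ⊎-dec ((n ℕ.≟ 2 ℕ.* k ℕ.+ 1) ×-dec (∣ z ∣ ℕ.≤? k))

  bound : M n z → ∃ λ k → k < suc n × Body k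
  bound (k , p@(inj₁ (refl , _))) = k , s≤s (ℕ.m≤m+n k _) , p
  bound (k , p@(inj₂ (refl , _))) =
    k , s≤s (ℕ.≤-trans (ℕ.m≤m+n k _) (ℕ.m≤m+n _ 1)) , p

private
  integersUpTo : ℕ → List ℤ
  integersUpTo n = map (λ i → + i) (upTo (suc n)) ++ map -[1+_] (upTo n)

  ∈-integersUpTo : ∀ {n} z → ∣ z ∣ ≤ n → z ∈ integersUpTo n
  ∈-integersUpTo (+ i)    i≤n = ∈-++⁺ˡ (∈-map⁺ (λ i → + i) (∈-upTo⁺ (s≤s i≤n)))
  ∈-integersUpTo -[1+ i ] i<n =
    ∈-++⁺ʳ (map (λ i → + i) (upTo (suc _))) (∈-map⁺ -[1+_] (∈-upTo⁺ i<n))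

  anyFunction? : ∀ {A : Set} k (xs : List A) {P : (Fin k → A) → Set} →
                 (∀ {f g} → f ≗ g → P f → P g) → Decidable P →
                 Dec (∃ λ f → (∀ i → f i ∈ xs) × P f)
  anyFunction? zero xs resp P? =
    map′ (λ p → Vector.[] , (λ ()) , p)
         (λ (_ , _ , p) → resp (λ ()) p)
         (P? Vector.[])
  anyFunction? {A} (suc k) xs {P} resp P? =
    map′ to from (Any.any? (λ x → anyFunction? k xs (resp ∘ cons x) (P? ∘ (x Vector.∷_))) xs)
    where
    cons : ∀ x {f g : Fin k → A} → f ≗ g → (x Vector.∷ f) ≗ (x Vector.∷ g)
    cons x eq zero    = refl
    cons x eq (suc i) = eq i

    Extends : A → Set
    Extends x = ∃ λ f → (∀ i → f i ∈ xs) × P (x Vector.∷ f)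

    to : Any.Any Extends xs → ∃ λ f → (∀ i → f i ∈ xs) × P f
    to a with find a
    ... | x , x∈xs , f , f∈xs , p = x Vector.∷ f , (λ { zero → x∈xs ; (suc i) → f∈xs i }) , p

    from : (∃ λ f → (∀ i → f i ∈ xs) × P f) → Any.Any Extends xs
    from (f , f∈xs , p) =
      lose (f∈xs zero)
           (f ∘ suc , f∈xs ∘ suc , resp (λ { zero → refl ; (suc i) → refl }) p)

  least : {P : ℕ → Set} → Decidable P → ∀ n → P n →
          ∃ λ m → P m × (∀ k → P k → m ≤ k)
  least P? zero p = 0 , p , λ _ _ → z≤n
  least P? (suc n) p with P? 0
  ... | yes p₀ = 0 , p₀ , λ _ _ → z≤n
  ... | no ¬p₀ with least (P? ∘ suc) n p
  ...   | m , pm , min = suc m , pm , λ where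
            zero    p₀ → contradiction p₀ ¬p₀
            (suc k) pk → s≤s (min k pk)

module _ (G : SimpleSignedGraph) where
  open SimpleSignedGraph G

  proper? : Decidable (Proper G)
  proper? φ = all? λ u → all? λ v → edge? u v (label u v)
    where
    edge? : ∀ u v l → Dec (∀ s → l ≡ just s → φ u ≢ (s ◃ 1) ℤ.* φ v)
    edge? u v nothing  = yes λ _ ()
    edge? u v (just s) =
      map′ (λ { ≢ _ refl → ≢ }) (λ h → h s refl) (¬? (φ u ℤ.≟ (s ◃ 1) ℤ.* φ v))

  colourable? : Decidable (Colourable G)
  colourable? n =
    map′ (λ (φ , _ , c) → φ , c)
         (λ (φ , c) → φ , (λ v → ∈-integersUpTo (φ v) (M⇒∣∣≤ n {φ v} (proj₁ c v))) , c)
         (anyFunction? order (integersUpTo n) resp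
           (λ φ → all? (λ v → M? n (φ v)) ×-dec proper? φ))
    where
    resp : ∀ {φ ψ} → φ ≗ ψ → Colouring G n φ → Colouring G n ψ
    resp eq (inM , proper) =
      (λ v → subst (M n) (eq v) (inM v)) ,
      (λ u v s e → subst₂ (λ a b → a ≢ (s ◃ 1) ℤ.* b) (eq u) (eq v) (proper u v s e))

  -- Distinct positive colours on distinct vertices are never equal or opposite.
  colourable-2order : Colourable G (2 ℕ.* order)
  colourable-2order = φ , inM , proper
    where
    φ : V → ℤ
    φ v = + suc (toℕ v)

    inM : ∀ v → M (2 ℕ.* order) (φ v)
    inM v = order , inj₁ (refl , s≤s z≤n , Fin.toℕ<n v)

    proper : Proper G φ
    proper u v s e eq with toℕ-injective (ℕ.suc-injective ∣eq∣)
      where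
      ∣s◃1∣ : ∀ s → ∣ s ◃ 1 ∣ ≡ 1
      ∣s◃1∣ Sign.+ = refl
      ∣s◃1∣ Sign.- = refl

      ∣eq∣ : suc (toℕ u) ≡ suc (toℕ v)
      ∣eq∣ = trans (cong ∣_∣ eq)
            (trans (ℤ.abs-* (s ◃ 1) (φ v))
            (trans (cong (ℕ._* suc (toℕ v)) (∣s◃1∣ s)) (ℕ.*-identityˡ _)))
    ... | refl with trans (sym e) (label-irrefl u)
    ...   | ()

  chromaticNumber : ∃ (IsChromaticNumber G)
  chromaticNumber
    with least (λ n → (1 ℕ.≤? n) ×-dec colourable? n) (2 ℕ.* order)
               (ℕ.≤-trans (ℕ.>-nonZero⁻¹ order) (ℕ.m≤m+n order _) , colourable-2order)
  ... | n , (1≤n , c) , min = n , 1≤n , c , λ m 1≤m cm → min m (1≤m , cm)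

  χ : ℕ
  χ = proj₁ chromaticNumber

{-# OPTIONS --safe #-}

-- Write n for Δ.  Each coloured neighbour of a vertex forbids at most one colour there, so a vertex
-- that has an uncoloured neighbour, or fewer than n neighbours, or two neighbours forbidding the
-- same colour, can be coloured.  If some vertex has degree less than n, colour all the others
-- towards it.  Otherwise G is regular.  As G is not complete and balanced, there are x ~ v ~ y such
-- that x and y are not adjacent or xvy is an unbalanced triangle; then colours ±1 at x and y can be
-- chosen so that both forbid the same colour at v.  Extend x, v, y to a path that is maximal at its
-- last vertex h (Zając's proof of Brooks' theorem).  The edge from h to its farthest neighbour on the
-- path closes a cycle containing all neighbours of h.
--   * If an edge leaves the cycle, there are consecutive vertices s, t of the cycle such that t has a
--     neighbour u outside the cycle and s has none.  Colour the outside towards the cycle, then s so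
--     that s and u forbid the same colour at t, then the rest of the cycle towards t.
--   * Otherwise the cycle spans G.  If n ≥ 3, colour x and y as above and then the rest towards v,
--     which has a third neighbour.  If n = 2, then G is a circuit, and a colouring by ±1 exists iff
--     the negated edge signs multiply to + around it.

module Submission where

open import Defs
open import Data.Empty using (⊥)
open import Data.Fin as Fin using (Fin)
import Data.Fin.Properties as Fin
open import Data.Integer as ℤ using (ℤ; +_; -[1+_]; ∣_∣; _◃_)
import Data.Integer.Properties as ℤ
open import Data.List as List using (List; []; _∷_; _++_; length; map; filter; allFin; [_])
open import Data.List.Extrema.Nat using (xs≤max)
open import Data.List.Membership.Propositional using (_∈_; _∉_; find; lose)
open import Data.List.Membership.Propositional.Properties
  using (∈-++⁺ˡ; ∈-++⁺ʳ; ∈-++⁻; ∈-∃++; ∈-map⁺; ∈-filter⁺; ∈-filter⁻; ∈-allFin)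
import Data.List.Properties as List
open import Data.List.Relation.Binary.Subset.Propositional using (_⊆_)
open import Data.List.Relation.Unary.All as All using (All; []; _∷_)
import Data.List.Relation.Unary.All.Properties as All
open import Data.List.Relation.Unary.AllPairs using ([]; _∷_)
open import Data.List.Relation.Unary.Any as Any using (Any; here; there)
open import Data.List.Relation.Unary.Linked using (Linked; []; [-]; _∷_)
open import Data.List.Relation.Unary.Unique.Propositional using (Unique)
import Data.List.Relation.Unary.Unique.Propositional.Properties as Unique
open import Data.Maybe using (just; fromMaybe)
import Data.Maybe.Properties as Maybe
open import Data.Nat as ℕ using (ℕ; zero; suc; _≤_; _<_; z≤n; s≤s; ⌊_/2⌋)
open import Data.Nat.Divisibility as ℕ using (_∣_; divides)
import Data.Nat.Properties as ℕ
open import Data.Product using (∃; ∃₂; _×_; _,_; proj₁; proj₂)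
open import Data.Sign as Sign using (Sign; opposite)
import Data.Sign.Properties as Sign
open import Data.Sum using (_⊎_; inj₁; inj₂)
import Data.Vec.Functional as Vector
import Data.Vec.Functional.Properties as Vector
open import Function using (_∘_; const)
open import Level using (0ℓ)
open import Relation.Binary.Construct.Closure.ReflexiveTransitive as Star using (Star; ε; _◅_; _◅◅_)
open import Relation.Binary.Definitions using (DecidableEquality)
open import Relation.Binary.PropositionalEquality
  using (_≡_; _≢_; refl; sym; trans; cong; cong₂; subst; module ≡-Reasoning)
open import Relation.Nullary using (¬_; Dec; yes; no; contradiction)
open import Relation.Nullary.Decidable using (decidable-stable; _×-dec_; _⊎-dec_; ¬?)
open import Relation.Unary using (Pred; Decidable)

-- Counting with repetition-free lists

module _ {A : Set} where

  ∈-++-remove : ∀ as {bs} {x w : A} → x ∈ as ++ w ∷ bs → x ≢ w → x ∈ as ++ bs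
  ∈-++-remove as x∈ x≢w with ∈-++⁻ as x∈
  ... | inj₁ x∈as         = ∈-++⁺ˡ x∈as
  ... | inj₂ (here x≡w)   = contradiction x≡w x≢w
  ... | inj₂ (there x∈bs) = ∈-++⁺ʳ as x∈bs

  -- Each entry of `xs` is deleted from `ys` in turn; uniqueness keeps the later entries in what
  -- remains.
  unique-⊆⇒length-≤ : ∀ {xs ys : List A} → Unique xs → xs ⊆ ys → length xs ≤ length ys
  unique-⊆⇒length-≤ []         _     = z≤n
  unique-⊆⇒length-≤ (x∉ ∷ uxs) xs⊆ys with ∈-∃++ (xs⊆ys (here refl))
  ... | as , bs , refl = subst (_ ≤_) (sym (List.length-++-sucʳ as _ bs))
    (s≤s (unique-⊆⇒length-≤ uxs λ z∈ →
      ∈-++-remove as (xs⊆ys (there z∈)) (λ { refl → All.lookup x∉ z∈ refl })))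

  unique-∷ : ∀ {x : A} {xs} → x ∉ xs → Unique xs → Unique (x ∷ xs)
  unique-∷ x∉ uxs = All.tabulate (λ { z∈ refl → x∉ z∈ }) ∷ uxs

  module _ (_≟_ : DecidableEquality A) where
    open import Data.List.Membership.DecPropositional _≟_ using (_∈?_)

    -- Pigeonhole. This later picks a free colour, and also a neighbour different from given
    -- vertices.
    ∃∉ : ∀ {xs ys : List A} → Unique xs → length ys < length xs → ∃ λ x → x ∈ xs × x ∉ ys
    ∃∉ {xs} {ys} uxs ys<xs with Any.any? (¬? ∘ (_∈? ys)) xs
    ... | yes any = find any
    ... | no none = contradiction ys<xs (ℕ.≤⇒≯ (unique-⊆⇒length-≤ uxs λ {z} z∈ →
      decidable-stable (z ∈? ys) λ z∉ → none (Any.map (λ { refl → z∉ }) z∈)))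

-- Backward induction: a repetition-free list over `Fin n` can be lengthened only finitely often,
-- and `k` bounds how often. It drives both the greedy colouring and the growth of a path.
unique-induction : ∀ {n} (P : List (Fin n) → Set) →
  (∀ T → Unique T → (∀ w → w ∉ T → P (w ∷ T)) → P T) → ∀ T → Unique T → P T
unique-induction {n} P step T uT = go n T uT (ℕ.m≤m+n n (length T))
  where
  go : ∀ k T → Unique T → n ≤ k ℕ.+ length T → P T
  go zero T uT n≤ = step T uT λ w w∉ → contradiction
    (ℕ.≤-trans (unique-⊆⇒length-≤ (unique-∷ w∉ uT) (λ _ → ∈-allFin _))
               (ℕ.≤-reflexive (List.length-tabulate {n = n} (λ i → i))))
    (ℕ.≤⇒≯ n≤)
  go (suc k) T uT n≤ = step T uT λ w w∉ →
    go k (w ∷ T) (unique-∷ w∉ uT) (subst (n ≤_) (sym (ℕ.+-suc k (length T))) n≤)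

-- Colour sets as lists

-- The set `M n`, listed so that its n entries can be counted against the forbidden colours. Passing
-- from n to n + 2 adds one new largest pair of opposite colours.
palette : ℕ → List ℤ
palette 0             = []
palette 1             = [ + 0 ]
palette (suc (suc n)) = + suc ⌊ n /2⌋ ∷ -[1+ ⌊ n /2⌋ ] ∷ palette n

length-palette : ∀ n → length (palette n) ≡ n
length-palette 0             = refl
length-palette 1             = refl
length-palette (suc (suc n)) = cong (suc ∘ suc) (length-palette n)

∈-palette⇒∣∣≤ : ∀ n {z} → z ∈ palette n → ∣ z ∣ ≤ ⌊ n /2⌋
∈-palette⇒∣∣≤ 1             (here refl)         = z≤n
∈-palette⇒∣∣≤ (suc (suc n)) (here refl)         = ℕ.≤-refl
∈-palette⇒∣∣≤ (suc (suc n)) (there (here refl)) = ℕ.≤-refl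
∈-palette⇒∣∣≤ (suc (suc n)) (there (there z∈))  = ℕ.m≤n⇒m≤1+n (∈-palette⇒∣∣≤ n z∈)

palette-unique : ∀ n → Unique (palette n)
palette-unique 0             = []
palette-unique 1             = [] ∷ []
palette-unique (suc (suc n)) =
  ((λ ()) ∷ All.tabulate λ { z∈ refl → ℕ.1+n≰n (∈-palette⇒∣∣≤ n z∈) }) ∷
  All.tabulate (λ { z∈ refl → ℕ.1+n≰n (∈-palette⇒∣∣≤ n z∈) }) ∷ palette-unique n

2+2*n≡2*suc : ∀ n → suc (suc (2 ℕ.* n)) ≡ 2 ℕ.* suc n
2+2*n≡2*suc n = sym (ℕ.*-suc 2 n)

halves : ∀ n → n ≡ 2 ℕ.* ⌊ n /2⌋ ⊎ n ≡ 2 ℕ.* ⌊ n /2⌋ ℕ.+ 1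
halves 0 = inj₁ refl
halves 1 = inj₂ refl
halves (suc (suc n)) with halves n
... | inj₁ eq = inj₁ (trans (cong (suc ∘ suc) eq) (2+2*n≡2*suc ⌊ n /2⌋))
... | inj₂ eq = inj₂ (trans (cong (suc ∘ suc) eq) (cong (ℕ._+ 1) (2+2*n≡2*suc ⌊ n /2⌋)))

M-nonzero : ∀ n z → 1 ≤ ∣ z ∣ → ∣ z ∣ ≤ ⌊ n /2⌋ → M n z
M-nonzero n z 1≤z z≤ with halves n
... | inj₁ eq = ⌊ n /2⌋ , inj₁ (eq , 1≤z , z≤)
... | inj₂ eq = ⌊ n /2⌋ , inj₂ (eq , z≤)

M-2+ : ∀ n z → M n z → M (2 ℕ.+ n) z
M-2+ _ z (k , inj₁ (refl , 1≤z , z≤k)) = suc k , inj₁ (2+2*n≡2*suc k , 1≤z , ℕ.m≤n⇒m≤1+n z≤k)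
M-2+ _ z (k , inj₂ (refl , z≤k))       =
  suc k , inj₂ (cong (ℕ._+ 1) (2+2*n≡2*suc k) , ℕ.m≤n⇒m≤1+n z≤k)

∈-palette⇒M : ∀ n z → z ∈ palette n → M n z
∈-palette⇒M 1             _ (here refl)           = 0 , inj₂ (refl , z≤n)
∈-palette⇒M (suc (suc n)) z (here refl)           = M-nonzero (2 ℕ.+ n) z (s≤s z≤n) ℕ.≤-refl
∈-palette⇒M (suc (suc n)) z (there (here refl))   = M-nonzero (2 ℕ.+ n) z (s≤s z≤n) ℕ.≤-refl
∈-palette⇒M (suc (suc n)) z (there (there z∈))    = M-2+ n z (∈-palette⇒M n z z∈)

-- Signs acting on colours, and parity

infixr 7 _•_

_•_ : Sign → ℤ → ℤ
s • z = (s ◃ 1) ℤ.* z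

◃1-* : ∀ s t → (s ◃ 1) ℤ.* (t ◃ 1) ≡ (s Sign.* t) ◃ 1
◃1-* Sign.+ Sign.+ = refl
◃1-* Sign.+ Sign.- = refl
◃1-* Sign.- Sign.+ = refl
◃1-* Sign.- Sign.- = refl

•-assoc : ∀ s t z → s • t • z ≡ (s Sign.* t) • z
•-assoc s t z = trans (sym (ℤ.*-assoc (s ◃ 1) (t ◃ 1) z)) (cong (ℤ._* z) (◃1-* s t))

+•_ : ∀ z → Sign.+ • z ≡ z
+•_ = ℤ.*-identityˡ

•-involutive : ∀ s z → s • s • z ≡ z
•-involutive s z = trans (•-assoc s s z) (trans (cong (_• z) (Sign.s*s≡+ s)) (+• z))

∣•∣ : ∀ s z → ∣ s • z ∣ ≡ ∣ z ∣
∣•∣ s z = trans (ℤ.abs-* (s ◃ 1) z) (trans (cong (ℕ._* ∣ z ∣) (ℤ.abs-◃ s 1)) (ℕ.*-identityˡ ∣ z ∣))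

M-• : ∀ n s z → M n z → M n (s • z)
M-• n s z (k , inj₁ (n≡ , 1≤ , ≤k)) =
  k , inj₁ (n≡ , subst (1 ≤_) (sym (∣•∣ s z)) 1≤ , subst (_≤ k) (sym (∣•∣ s z)) ≤k)
M-• n s z (k , inj₂ (n≡ , ≤k))      = k , inj₂ (n≡ , subst (_≤ k) (sym (∣•∣ s z)) ≤k)

M-◃1 : ∀ n s → 2 ≤ n → M n (s ◃ 1)
M-◃1 n s 2≤n = M-nonzero n (s ◃ 1) (ℕ.≤-reflexive (sym (ℤ.abs-◃ s 1)))
  (subst (_≤ ⌊ n /2⌋) (sym (ℤ.abs-◃ s 1)) (ℕ.⌊n/2⌋-mono 2≤n))

s*[s*t]≡t : ∀ s t → s Sign.* (s Sign.* t) ≡ t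
s*[s*t]≡t s t = trans (sym (Sign.*-assoc s s t)) (cong (Sign._* t) (Sign.s*s≡+ s))

opposite-*ˡ : ∀ s t → opposite (s Sign.* t) ≡ opposite s Sign.* t
opposite-*ˡ Sign.+ t = refl
opposite-*ˡ Sign.- t = Sign.opposite-involutive t

-- The sign of (-1)^n.
parity : ℕ → Sign
parity zero    = Sign.+
parity (suc n) = opposite (parity n)

parity≡+⇒2∣ : ∀ n → parity n ≡ Sign.+ → 2 ∣ n
parity≡+⇒2∣ zero          _  = divides 0 refl
parity≡+⇒2∣ (suc (suc n)) eq =
  ℕ.∣m∣n⇒∣m+n (ℕ.∣-refl {2}) (parity≡+⇒2∣ n (trans (sym (Sign.opposite-involutive (parity n))) eq))

2∣⇒parity≡+ : ∀ n → 2 ∣ n → parity n ≡ Sign.+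
2∣⇒parity≡+ _ (divides zero    refl) = refl
2∣⇒parity≡+ _ (divides (suc q) refl) =
  trans (Sign.opposite-involutive _) (2∣⇒parity≡+ (q ℕ.* 2) (divides q refl))

-- Splitting lists and locating neighbouring entries

module _ {A : Set} where

  unique-++⁻ʳ : ∀ (xs : List A) {ys} → Unique (xs ++ ys) → Unique ys
  unique-++⁻ʳ []       u       = u
  unique-++⁻ʳ (x ∷ xs) (_ ∷ u) = unique-++⁻ʳ xs u

  unique-++⁻ˡ : ∀ (xs : List A) {ys} → Unique (xs ++ ys) → Unique xs
  unique-++⁻ˡ []       _        = []
  unique-++⁻ˡ (x ∷ xs) (x∉ ∷ u) = All.++⁻ˡ xs x∉ ∷ unique-++⁻ˡ xs u

  unique-++⁻-disjoint : ∀ (xs : List A) {ys x y} → Unique (xs ++ ys) → x ∈ xs → y ∈ ys → x ≢ y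
  unique-++⁻-disjoint (x ∷ xs) (x∉ ∷ _) (here refl) y∈ = All.lookup (All.++⁻ʳ xs x∉) y∈
  unique-++⁻-disjoint (x ∷ xs) (_ ∷ u)  (there x∈)  y∈ = unique-++⁻-disjoint xs u x∈ y∈

  module _ {R : A → A → Set} where

    linked-++⁻ʳ : ∀ xs {ys} → Linked R (xs ++ ys) → Linked R ys
    linked-++⁻ʳ []       lk = lk
    linked-++⁻ʳ (x ∷ []) {[]}    lk        = []
    linked-++⁻ʳ (x ∷ []) {_ ∷ _} (_ ∷ lk)  = lk
    linked-++⁻ʳ (x ∷ xs@(_ ∷ _)) (_ ∷ lk)  = linked-++⁻ʳ xs lk

    linked-++⁻ˡ : ∀ xs {ys} → Linked R (xs ++ ys) → Linked R xs
    linked-++⁻ˡ []               _        = []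
    linked-++⁻ˡ (x ∷ [])         _        = [-]
    linked-++⁻ˡ (x ∷ xs@(_ ∷ _)) (r ∷ lk) = r ∷ linked-++⁻ˡ xs lk

  lastOf : A → List A → A
  lastOf a []      = a
  lastOf a (b ∷ l) = lastOf b l

  lastOf-++ : ∀ a l {b m} → lastOf a (l ++ b ∷ m) ≡ lastOf b m
  lastOf-++ a []      = refl
  lastOf-++ a (c ∷ l) = lastOf-++ c l

  lastOf∈ : ∀ a l → lastOf a l ∈ a ∷ l
  lastOf∈ a []      = here refl
  lastOf∈ a (b ∷ l) = there (lastOf∈ b l)

  consecutive : A → List A → List (A × A)
  consecutive a []      = []
  consecutive a (b ∷ l) = (a , b) ∷ consecutive b l

  -- The predecessor and the successor differ because entries do not repeat. The last entry has its
  -- successor only through the closing edge of a cycle, so it is kept apart.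
  interior : ∀ {a l u} → Unique (a ∷ l) → u ∈ l → u ≡ lastOf a l ⊎
    ∃₂ λ p s → p ≢ s × (p , u) ∈ consecutive a l × (u , s) ∈ consecutive a l
  interior {l = b ∷ []}    _       (here refl) = inj₁ refl
  interior {a} {b ∷ c ∷ l} ((_ ∷ a≢c ∷ _) ∷ _) (here refl) =
    inj₂ (a , c , a≢c , here refl , there (here refl))
  interior {l = b ∷ l}     (_ ∷ u) (there u∈)  with interior u u∈
  ... | inj₁ eq                     = inj₁ eq
  ... | inj₂ (p , s , p≢s , p∈ , s∈) = inj₂ (p , s , p≢s , there p∈ , there s∈)

  before-last : ∀ a b l → ∃ λ p → p ∈ a ∷ b ∷ l × (p , lastOf b l) ∈ consecutive a (b ∷ l)
  before-last a b []      = a , here refl , here refl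
  before-last a b (c ∷ l) with before-last b c l
  ... | p , p∈ , e = p , there p∈ , there e

  module _ {P : Pred A 0ℓ} (P? : Decidable P) where

    lastSatisfying : ∀ {l} → Any P l → ∃ λ as → ∃₂ λ z bs → l ≡ as ++ z ∷ bs × P z × All (¬_ ∘ P) bs
    lastSatisfying {x ∷ l} any with Any.any? P? l
    ... | yes any′ = let as , z , bs , eq , Pz , none = lastSatisfying any′ in
                     x ∷ as , z , bs , cong (x ∷_) eq , Pz , none
    lastSatisfying {x ∷ l} (here Px)    | no none = [] , x , l , refl , Px , All.¬Any⇒All¬ l none
    lastSatisfying {x ∷ l} (there any′) | no none = contradiction any′ none

    crossing : ∀ {h l} → ¬ P h → Any P l →
      ∃₂ λ as s → ∃₂ λ t bs → h ∷ l ≡ as ++ s ∷ t ∷ bs × ¬ P s × P t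
    crossing {h} {x ∷ l} ¬Ph any with P? x
    ... | yes Px = [] , h , x , l , refl , ¬Ph , Px
    crossing {h} {x ∷ l} ¬Ph (here Px)   | no ¬Px = contradiction Px ¬Px
    crossing {h} {x ∷ l} ¬Ph (there any) | no ¬Px =
      let as , s , t , bs , eq , ¬Ps , Pt = crossing ¬Px any in
      h ∷ as , s , t , bs , cong (h ∷_) eq , ¬Ps , Pt

-- Adjacency and walks inside a vertex set

module _ (G : SimpleSignedGraph) where
  open SimpleSignedGraph G
  open import Data.List.Membership.DecPropositional (Fin._≟_ {order}) using (_∈?_)

  -- Junk value + on non-adjacent pairs.
  sgn : V → V → Sign
  sgn u v = fromMaybe Sign.+ (label u v)

  label⇒sgn : ∀ {u v s} → label u v ≡ just s → sgn u v ≡ s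
  label⇒sgn = cong (fromMaybe Sign.+)

  sgn-sym : ∀ u v → sgn u v ≡ sgn v u
  sgn-sym u v = cong (fromMaybe Sign.+) (label-sym u v)

  adj-sym : ∀ {u v} → Adjacent u v → Adjacent v u
  adj-sym {u} {v} (s , e) = s , trans (label-sym v u) e

  adj⇒≢ : ∀ {u v} → Adjacent u v → u ≢ v
  adj⇒≢ {u} (s , e) refl with trans (sym e) (label-irrefl u)
  ... | ()

  neighbours : V → List V
  neighbours v = filter (adjacent? v) (allFin order)

  neighbours-unique : ∀ v → Unique (neighbours v)
  neighbours-unique v = Unique.filter⁺ (adjacent? v) (Unique.allFin⁺ order)

  ∈-neighbours⁺ : ∀ {v u} → Adjacent v u → u ∈ neighbours v
  ∈-neighbours⁺ {v} vu = ∈-filter⁺ (adjacent? v) (∈-allFin _) vu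

  ∈-neighbours⁻ : ∀ {v u} → u ∈ neighbours v → Adjacent v u
  ∈-neighbours⁻ {v} u∈ = proj₂ (∈-filter⁻ (adjacent? v) {xs = allFin order} u∈)

  JoinedIn : Pred V 0ℓ → V → V → Set
  JoinedIn U = Star (λ a b → Adjacent a b × U a × U b)

  joinedIn-sym : ∀ {U a b} → JoinedIn U a b → JoinedIn U b a
  joinedIn-sym = Star.reverse λ (ab , a , b) → adj-sym ab , b , a

  -- Supplies the vertex `w` next to T that `greedy` colours after all others outside T.
  entry : ∀ {U a b} T → JoinedIn U a b → a ∉ T → b ∈ T →
          ∃₂ λ w t → w ∉ T × t ∈ T × Adjacent w t × U w × U t
  entry T ε a∉ b∈ = contradiction b∈ a∉
  entry T (_◅_ {j = c} (ac , Ua , Uc) p) a∉ b∈ with c ∈? T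
  ... | yes c∈ = _ , _ , a∉ , c∈ , ac , Ua , Uc
  ... | no  c∉ = entry T p c∉ b∈

  -- Partial colourings and their greedy extension

  module _ (n : ℕ) where

    -- A partial colouring with domain D; the values of φ outside D are arbitrary.
    ColouringOn : Pred V 0ℓ → (V → ℤ) → Set
    ColouringOn D φ = (∀ v → D v → M n (φ v)) ×
      (∀ u v s → D u → D v → label u v ≡ just s → φ u ≢ s • φ v)

    restrict : ∀ {D E φ} → (∀ v → E v → D v) → ColouringOn D φ → ColouringOn E φ
    restrict E⊆D (inM , proper) =
      (λ v Ev → inM v (E⊆D v Ev)) ,
      (λ u v s Eu Ev → proper u v s (E⊆D u Eu) (E⊆D v Ev))

    forbidden : (V → ℤ) → V → V → ℤ
    forbidden φ v u = sgn v u • φ u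

    module _ {D : Pred V 0ℓ} {φ : V → ℤ} (v : V) (z : ℤ) where

      recoloured : V → ℤ
      recoloured = Vector.updateAt φ v (const z)

      recoloured-new : recoloured v ≡ z
      recoloured-new = Vector.updateAt-updates v φ

      recoloured-old : ∀ {u} → u ≢ v → recoloured u ≡ φ u
      recoloured-old u≢v = Vector.updateAt-minimal _ v φ u≢v

      recolour : ColouringOn D φ → M n z → (∀ u → Adjacent v u → D u → z ≢ forbidden φ v u) →
                 ColouringOn (λ u → D u ⊎ u ≡ v) recoloured
      recolour (inM , proper) Mz free = inM′ , proper′
        where
        inM′ : ∀ u → D u ⊎ u ≡ v → M n (recoloured u)
        inM′ u Du with u Fin.≟ v
        ... | yes refl = subst (M n) (sym recoloured-new) Mz
        inM′ u (inj₁ Du)  | no u≢v = subst (M n) (sym (recoloured-old u≢v)) (inM u Du)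
        inM′ u (inj₂ u≡v) | no u≢v = contradiction u≡v u≢v

        at-v : ∀ u s → D u ⊎ u ≡ v → label v u ≡ just s → recoloured v ≢ s • recoloured u
        at-v u s Du e eq with u Fin.≟ v
        ... | yes refl = adj⇒≢ (s , e) refl
        at-v u s (inj₂ u≡v) e eq | no u≢v = u≢v u≡v
        at-v u s (inj₁ Du)  e eq | no u≢v = free u (s , e) Du
          (trans (sym recoloured-new)
          (trans eq (cong₂ _•_ (sym (label⇒sgn e)) (recoloured-old u≢v))))

        proper′ : ∀ u w s → D u ⊎ u ≡ v → D w ⊎ w ≡ v → label u w ≡ just s →
                  recoloured u ≢ s • recoloured w
        proper′ u w s Du Dw e eq with u Fin.≟ v | w Fin.≟ v
        ... | yes refl | _        = at-v w s Dw e eq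
        -- The same edge read from its other end: acting twice by `s` is the identity.
        ... | no _     | yes refl = at-v u s Du (trans (label-sym v u) e)
          (sym (trans (cong (s •_) eq) (•-involutive s _)))
        proper′ u w s (inj₂ u≡v) _          e eq | no u≢v | no _   = u≢v u≡v
        proper′ u w s (inj₁ _)   (inj₂ w≡v) e eq | no _   | no w≢v = w≢v w≡v
        proper′ u w s (inj₁ Du)  (inj₁ Dw)  e eq | no u≢v | no w≢v = proper u w s Du Dw e
          (trans (sym (recoloured-old u≢v)) (trans eq (cong (s •_) (recoloured-old w≢v))))

    -- The three reasons why the coloured neighbours of a vertex of degree at most n forbid fewer
    -- than n colours.
    data Slack (D : Pred V 0ℓ) (φ : V → ℤ) (v : V) : Set where
      deficient  : degree v < n → Slack D φ v
      uncoloured : ∀ w → Adjacent v w → ¬ D w → Slack D φ v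
      agreeing   : ∀ a b → a ≢ b → Adjacent v a → Adjacent v b →
                   forbidden φ v a ≡ forbidden φ v b → Slack D φ v

    module _ (degree≤n : ∀ v → degree v ≤ n) where

      neighbours-remove : ∀ v w → Adjacent v w →
        ∃ λ L → length L < n × (∀ u → Adjacent v u → u ≢ w → u ∈ L)
      neighbours-remove v w vw with neighbours v in eq | ∈-∃++ (∈-neighbours⁺ vw)
      ... | _ | as , bs , refl = as ++ bs ,
        subst (_≤ n) (trans (cong length eq) (List.length-++-sucʳ as w bs)) (degree≤n v) ,
        λ u vu u≢w → ∈-++-remove as (subst (u ∈_) eq (∈-neighbours⁺ vu)) u≢w

      slack⇒few-forbidden : ∀ {D φ v} → Slack D φ v →
        ∃ λ (Z : List ℤ) → length Z < n × (∀ u → Adjacent v u → D u → forbidden φ v u ∈ Z)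
      slack⇒few-forbidden {D} {φ} {v} = λ where
          (deficient d) → image (neighbours v , d , λ u vu _ → u , ∈-neighbours⁺ vu , refl)
          (uncoloured w vw ¬Dw) → let L , L<n , ∈L = neighbours-remove v w vw in
            image (L , L<n , λ u vu Du → u , ∈L u vu (λ { refl → ¬Dw Du }) , refl)
          (agreeing a b a≢b va vb eq) → let L , L<n , ∈L = neighbours-remove v b vb in
            image (L , L<n , λ u vu _ → agree a b a≢b va eq L ∈L u vu)
        where
        -- Forbidden colours are counted through a short list of representatives. With two agreeing
        -- neighbours, `b` is dropped and `a` represents it.
        Represented : List V → Set
        Represented L = ∀ u → Adjacent v u → D u →
                        ∃ λ u′ → u′ ∈ L × forbidden φ v u ≡ forbidden φ v u′

        image : (∃ λ L → length L < n × Represented L) →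
                ∃ λ (Z : List ℤ) → length Z < n × (∀ u → Adjacent v u → D u → forbidden φ v u ∈ Z)
        image (L , L<n , rep) = map (forbidden φ v) L ,
          subst (_< n) (sym (List.length-map (forbidden φ v) L)) L<n , λ u vu Du →
          let u′ , u′∈ , eq = rep u vu Du in
          subst (_∈ map (forbidden φ v) L) (sym eq) (∈-map⁺ (forbidden φ v) u′∈)

        agree : ∀ a b → a ≢ b → Adjacent v a → forbidden φ v a ≡ forbidden φ v b →
                ∀ L → (∀ u → Adjacent v u → u ≢ b → u ∈ L) → ∀ u → Adjacent v u →
                ∃ λ u′ → u′ ∈ L × forbidden φ v u ≡ forbidden φ v u′
        agree a b a≢b va eq L ∈L u vu with u Fin.≟ b
        ... | yes refl = a , ∈L a va a≢b , sym eq
        ... | no u≢b   = u , ∈L u vu u≢b , refl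

      extend : ∀ {D φ} v → ColouringOn D φ → Slack D φ v →
        ∃ λ ψ → (∀ {u} → u ≢ v → ψ u ≡ φ u) × ColouringOn (λ u → D u ⊎ u ≡ v) ψ
      extend {D} {φ} v col slack =
        let Z , Z<n , ∈Z = slack⇒few-forbidden slack
            z , z∈ , z∉Z = ∃∉ ℤ._≟_ (palette-unique n) (subst (length Z <_) (sym (length-palette n)) Z<n)
        in recoloured {D} {φ} v z , recoloured-old {D} {φ} v z ,
           recolour v z col (∈-palette⇒M n z z∈) λ u vu Du z≡ → z∉Z (subst (_∈ Z) (sym z≡) (∈Z u vu Du))

      -- The vertices outside T are coloured in order of decreasing distance from T, so that each of
      -- them still has an uncoloured neighbour when its turn comes.
      greedy : ∀ {D φ} → Decidable D → ColouringOn D φ → ∀ T → Unique T →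
        (∀ u → ¬ D u → ∃ λ t → t ∈ T × JoinedIn (¬_ ∘ D) u t) →
        ∃ λ ψ → (∀ {u} → D u → ψ u ≡ φ u) × ColouringOn (_∉ T) ψ
      greedy {D} {φ} D? col = unique-induction Colours step
        where
        Colours : List V → Set
        Colours T = (∀ u → ¬ D u → ∃ λ t → t ∈ T × JoinedIn (¬_ ∘ D) u t) →
                    ∃ λ ψ → (∀ {u} → D u → ψ u ≡ φ u) × ColouringOn (_∉ T) ψ

        step : ∀ T → Unique T → (∀ w → w ∉ T → Colours (w ∷ T)) → Colours T
        step T _ ih joined with Fin.any? (λ u → ¬? (u ∈? T) ×-dec ¬? (D? u))
        ... | no none = φ , (λ _ → refl) ,
          restrict (λ v v∉ → decidable-stable (D? v) λ ¬Dv → none (v , v∉ , ¬Dv)) col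
        ... | yes (u , u∉ , ¬Du) =
          -- The induction hypothesis colours everything outside `w ∷ T` first. Since `t` lies in T
          -- and is still uncoloured, `w` then has slack.
          let t₀ , t₀∈ , p = joined u ¬Du
              w , t , w∉ , t∈ , wt , ¬Dw , _ = entry T p u∉ t₀∈
              ψ , ψ≡φ , colψ = ih w w∉ λ u′ ¬Du′ →
                let t′ , t′∈ , q = joined u′ ¬Du′ in t′ , there t′∈ , q
              χ′ , χ≡ψ , colχ = extend w colψ (uncoloured t wt λ t∉ → t∉ (there t∈))
          in χ′ , (λ Dx → trans (χ≡ψ (λ { refl → ¬Dw Dx })) (ψ≡φ Dx)) ,
             restrict (λ x x∉ → outside w x x∉) colχ
          where
          outside : ∀ w x → x ∉ T → x ∉ w ∷ T ⊎ x ≡ w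
          outside w x x∉ with x Fin.≟ w
          ... | yes x≡w = inj₂ x≡w
          ... | no  x≢w = inj₁ λ { (here x≡w) → x≢w x≡w ; (there x∈) → x∉ x∈ }

      module _ {D φ} (D? : Decidable D) (col : ColouringOn D φ) (t : V)
               (joined : ∀ u → ¬ D u → JoinedIn (¬_ ∘ D) u t) where

        -- Here `t` is coloured last. Its slack may rely on the precoloured vertices having kept
        -- their colours.
        colourable-towards : (∀ ψ → (∀ {u} → D u → ψ u ≡ φ u) → Slack (_∉ [ t ]) ψ t) → Colourable G n
        colourable-towards slack =
          let ψ , ψ≡φ , colψ    = greedy D? col [ t ] ([] ∷ []) λ u ¬Du → t , here refl , joined u ¬Du
              χ′ , _ , inM , proper = extend t colψ (slack ψ ψ≡φ)
          in χ′ , (λ v → inM v (all v)) , λ u v s → proper u v s (all u) (all v)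
          where
          all : ∀ v → v ∉ [ t ] ⊎ v ≡ t
          all v with v Fin.≟ t
          ... | yes v≡t = inj₂ v≡t
          ... | no  v≢t = inj₁ λ { (here v≡t) → v≢t v≡t }

        colourable-agreeing : ∀ a b → a ≢ b → D a → D b → Adjacent t a → Adjacent t b →
          forbidden φ t a ≡ forbidden φ t b → Colourable G n
        colourable-agreeing a b a≢b Da Db ta tb eq = colourable-towards λ ψ ψ≡φ →
          agreeing a b a≢b ta tb
            (trans (cong (sgn t a •_) (ψ≡φ Da)) (trans eq (cong (sgn t b •_) (sym (ψ≡φ Db)))))

  -- Cherries, and graphs without them

  -- Precolouring x and y so that both forbid the colour 1 at v is proper exactly for cherries.
  Cherry : V → V → V → Set
  Cherry v x y = x ≢ y × ∃₂ λ s t →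
    label v x ≡ just s × label v y ≡ just t × label x y ≢ just (s Sign.* t)

  cherry? : ∀ v x y → Dec (Cherry v x y)
  cherry? v x y with x Fin.≟ y | adjacent? v x | adjacent? v y
  ... | yes x≡y | _ | _ = no λ (x≢y , _) → x≢y x≡y
  ... | no x≢y | no ¬vx | _ = no λ (_ , s , _ , e , _) → ¬vx (s , e)
  ... | no x≢y | yes _ | no ¬vy = no λ (_ , _ , t , _ , e , _) → ¬vy (t , e)
  ... | no x≢y | yes (s , vx) | yes (t , vy) with Maybe.≡-dec Sign._≟_ (label x y) (just (s Sign.* t))
  ...   | no  ne = yes (x≢y , s , t , vx , vy , ne)
  ...   | yes eq = no λ (_ , s′ , t′ , vx′ , vy′ , ne) →
    ne (trans eq (cong₂ (λ s t → just (s Sign.* t))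
                        (Maybe.just-injective (trans (sym vx) vx′))
                        (Maybe.just-injective (trans (sym vy) vy′))))

  productOf : List Sign → Sign
  productOf = List.foldr Sign._*_ Sign.+

  module _ (cherryless : ∀ v x y → ¬ Cherry v x y) where

    -- Let an edge xz be prepended to a walk that acts like a single edge zy. If x = y, the same
    -- sign occurs twice and cancels; otherwise the absence of a cherry at z makes xy an edge whose
    -- sign is the product. Walks between distinct vertices then give completeness, closed walks
    -- give balance.
    cherryless-walk : ∀ {x y} (w : Walk x y) →
      x ≡ y × productOf (signs w) ≡ Sign.+ ⊎ label x y ≡ just (productOf (signs w))
    cherryless-walk ε = inj₁ (refl , refl)
    cherryless-walk {x} {y} (_◅_ {j = z} (s , xz) w) with cherryless-walk w
    ... | inj₁ (refl , eq) =
      inj₂ (trans xz (cong just (sym (trans (cong (s Sign.*_) eq) (Sign.*-identityʳ s)))))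
    ... | inj₂ zy with x Fin.≟ y
    ...   | yes refl = inj₁ (refl , trans
      (cong (s Sign.*_) (Maybe.just-injective (trans (sym zy) (trans (label-sym z x) xz)))) (Sign.s*s≡+ s))
    ...   | no x≢y = inj₂ (decidable-stable (Maybe.≡-dec Sign._≟_ _ _) λ ne →
      cherryless z x y (x≢y , s , productOf (signs w) , trans (label-sym z x) xz , zy , ne))

    cherryless⇒complete : Connected → Complete
    cherryless⇒complete connected u v u≢v with cherryless-walk (connected u v)
    ... | inj₁ (u≡v , _) = contradiction u≡v u≢v
    ... | inj₂ uv        = _ , uv

    cherryless⇒balanced : Balanced
    cherryless⇒balanced C with cherryless-walk (Circuit.walk C)
    ... | inj₁ (_ , eq) = eq
    ... | inj₂ loop with trans (sym loop) (label-irrefl _)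
    ...   | ()

  -- Potentials and sign products around circuits

  ∏ : (V → V → Sign) → List (V × V) → Sign
  ∏ τ []             = Sign.+
  ∏ τ ((u , v) ∷ es) = τ u v Sign.* ∏ τ es

  productOf-signs : ∀ {u v} (w : Walk u v) → productOf (signs w) ≡ ∏ sgn (steps w)
  productOf-signs ε             = refl
  productOf-signs ((s , e) ◅ w) = cong₂ Sign._*_ (sym (label⇒sgn e)) (productOf-signs w)

  ∏-opposite : ∀ τ es → ∏ (λ u v → opposite (τ u v)) es ≡ parity (length es) Sign.* ∏ τ es
  ∏-opposite τ []             = refl
  ∏-opposite τ ((u , v) ∷ es) = begin
    opposite (τ u v) Sign.* ∏ (λ u v → opposite (τ u v)) es
      ≡⟨ cong (opposite (τ u v) Sign.*_) (∏-opposite τ es) ⟩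
    opposite (τ u v) Sign.* (parity (length es) Sign.* ∏ τ es)
      ≡⟨ rearrange (τ u v) (parity (length es)) (∏ τ es) ⟩
    opposite (parity (length es)) Sign.* (τ u v Sign.* ∏ τ es) ∎
    where
    open ≡-Reasoning
    rearrange : ∀ a b c → opposite a Sign.* (b Sign.* c) ≡ opposite b Sign.* (a Sign.* c)
    rearrange Sign.+ Sign.+ c = refl
    rearrange Sign.+ Sign.- c = Sign.opposite-involutive c
    rearrange Sign.- Sign.+ c = sym (Sign.opposite-involutive c)
    rearrange Sign.- Sign.- c = refl

  start∈ : ∀ {a b} (w : Walk a b) → a ∈ b ∷ map proj₁ (steps w)
  start∈ ε       = here refl
  start∈ (_ ◅ _) = there (here refl)

  step-target : ∀ {a b p q} (w : Walk a b) → (p , q) ∈ steps w → q ∈ b ∷ map proj₁ (steps w)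
  step-target (_ ◅ w) (here refl) with start∈ w
  ... | here eq  = here eq
  ... | there q∈ = there (there q∈)
  step-target (_ ◅ w) (there pq∈) with step-target w pq∈
  ... | here eq  = here eq
  ... | there q∈ = there (there q∈)

  module _ (τ : V → V → Sign) where

    -- A switching function: switching at the vertices where `f` is negative makes τ positive on all
    -- listed edges.
    IsPotential : (V → Sign) → List (V × V) → Set
    IsPotential f es = ∀ {p q} → (p , q) ∈ es → f p ≡ τ p q Sign.* f q

    -- Values are assigned backwards from the end `b`. As the vertices are distinct, setting the
    -- value at `a` disturbs no earlier equation.
    path-potential : ∀ {a b} (w : Walk a b) → Unique (b ∷ map proj₁ (steps w)) →
      ∃ λ f → f b ≡ Sign.+ × f a ≡ ∏ τ (steps w) × IsPotential f (steps w)
    path-potential ε _ = const Sign.+ , refl , refl , λ ()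
    path-potential {a} {b} (_◅_ {j = c} ac w) ((b≢a ∷ b∉) ∷ a∉ ∷ uw) =
      let f , fb , fc , pot = path-potential w (b∉ ∷ uw)
          f′  = Vector.updateAt f a (const (τ a c Sign.* f c))
          new = Vector.updateAt-updates a f
          old : ∀ {u} → u ∈ b ∷ map proj₁ (steps w) → f′ u ≡ f u
          old {u} u∈ = Vector.updateAt-minimal u a f (≢a u∈)
      in f′ , trans (old (here refl)) fb , trans new (cong (τ a c Sign.*_) fc) , λ where
        (here refl) → trans new (cong (τ a c Sign.*_) (sym (old (start∈ w))))
        {p} {q} (there pq∈) → trans (old (there (∈-map⁺ proj₁ pq∈)))
          (trans (pot pq∈) (cong (τ p q Sign.*_) (sym (old (step-target w pq∈)))))
      where
      ≢a : ∀ {u} → u ∈ b ∷ map proj₁ (steps w) → u ≢ a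
      ≢a (here refl) = b≢a
      ≢a (there u∈)  = λ { refl → All.lookup a∉ u∈ refl }

    -- Without its first edge the circuit is a path ending at the base. The equation of that first
    -- edge then says that the product around the circuit is +.
    circuit-potential : ∀ C → ∏ τ (edges C) ≡ Sign.+ → ∃ λ f → IsPotential f (edges C)
    circuit-potential C ∏≡+ with Circuit.walk C | Circuit.3≤size C | Circuit.distinct C
    ... | ε      | () | _
    ... | _ ◅ w | _  | u = let f , fa , fc , pot = path-potential w u in f , λ where
      (here refl) → trans fa (trans (sym ∏≡+) (cong (τ _ _ Sign.*_) (sym fc)))
      (there pq∈) → pot pq∈

    whole-potential : (∀ u v → τ u v ≡ τ v u) → ∀ C → C IsWholeGraph → ∏ τ (edges C) ≡ Sign.+ →
      ∃ λ f → ∀ u v → Adjacent u v → f u ≡ τ u v Sign.* f v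
    whole-potential τ-sym C (_ , covers) ∏≡+ = let f , pot = circuit-potential C ∏≡+ in
      f , λ u v uv → oriented f pot u v (covers u v uv)
      where
      oriented : ∀ f → IsPotential f (edges C) → ∀ u v → (u , v) ∈ edges C ⊎ (v , u) ∈ edges C →
                 f u ≡ τ u v Sign.* f v
      oriented f pot u v (inj₁ uv∈) = pot uv∈
      oriented f pot u v (inj₂ vu∈) = sym
        (trans (cong₂ Sign._*_ (τ-sym u v) (pot vu∈)) (s*[s*t]≡t (τ v u) (f u)))

  -- A potential for the edge signs telescopes along any walk, so every closed walk has sign +. No
  -- comparison of `C′` with `C` is required.
  whole-positive⇒balanced : ∀ C → C IsWholeGraph → sign C ≡ Sign.+ → Balanced
  whole-positive⇒balanced C whole sign≡+ C′ =
    Sign.*-cancelʳ-≡ (f (Circuit.base C′)) _ _ (sym (telescope (Circuit.walk C′)))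
    where
    potential = whole-potential sgn (sgn-sym) C whole
                  (trans (sym (productOf-signs (Circuit.walk C))) sign≡+)
    f = proj₁ potential

    telescope : ∀ {a b} (w : Walk a b) → f a ≡ productOf (signs w) Sign.* f b
    telescope ε = refl
    telescope {a} {b} (_◅_ {j = c} (s , ac) w) = begin
      f a                                        ≡⟨ proj₂ potential a c (s , ac) ⟩
      sgn a c Sign.* f c                         ≡⟨ cong₂ Sign._*_ (label⇒sgn ac) (telescope w) ⟩
      s Sign.* (productOf (signs w) Sign.* f b)  ≡⟨ Sign.*-assoc s _ _ ⟨
      s Sign.* productOf (signs w) Sign.* f b    ∎
      where open ≡-Reasoning

  -- A proper colouring by ±1 is a potential for the negated signs.
  whole-circuit-colourable : ∀ n → 2 ≤ n → ∀ C → C IsWholeGraph →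
    ¬ (IsOddCircuit × Balanced) → ¬ (IsEvenCircuit × ¬ Balanced) → Colourable G n
  whole-circuit-colourable n 2≤n C whole notOdd notEven =
    (λ v → f v ◃ 1) , (λ v → M-◃1 n (f v) 2≤n) , λ u v s e eq →
      Sign.s≢opposite[s] (s Sign.* f v) (trans (sym (◃1-injective (trans eq (◃1-* s (f v)))))
        (trans (proj₂ potential u v (s , e))
        (trans (cong (λ s → opposite s Sign.* f v) (label⇒sgn e)) (sym (opposite-*ˡ s (f v))))))
    where
    ◃1-injective : ∀ {s t} → s ◃ 1 ≡ t ◃ 1 → s ≡ t
    ◃1-injective {s} {t} = ℤ.sign-cong {1} {1} {s} {t}

    -- The product of the negated signs is (-1)^size times the sign of `C`. The two factors disagree
    -- only for an unbalanced even circuit or a balanced odd one, the excluded cases.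
    negated≡+ : ∏ (λ u v → opposite (sgn u v)) (edges C) ≡ Sign.+
    negated≡+ rewrite ∏-opposite sgn (edges C) | sym (productOf-signs (Circuit.walk C))
      with parity (size C) in even | sign C in positive
    ... | Sign.+ | Sign.+ = refl
    ... | Sign.- | Sign.- = refl
    ... | Sign.+ | Sign.- = contradiction
      ((C , whole , parity≡+⇒2∣ (size C) even) ,
       λ balanced → Sign.s≢opposite[s] Sign.+ (trans (sym (balanced C)) positive)) notEven
    ... | Sign.- | Sign.+ = contradiction
      ((C , whole , λ 2∣ → Sign.s≢opposite[s] Sign.+ (trans (sym (2∣⇒parity≡+ (size C) 2∣)) even)) ,
       whole-positive⇒balanced C whole positive) notOdd

    potential = whole-potential (λ u v → opposite (sgn u v)) (λ u v → cong opposite (sgn-sym u v))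
                  C whole negated≡+
    f = proj₁ potential

  -- Cycles as vertex lists

  module _ {b : V} where

    closedWalk : ∀ {a l} → Linked Adjacent (a ∷ l) → Adjacent (lastOf a l) b → Walk a b
    closedWalk [-]      e = e ◅ ε
    closedWalk (r ∷ lk) e = r ◅ closedWalk lk e

    closedWalk-vertices : ∀ {a l} (lk : Linked Adjacent (a ∷ l)) (e : Adjacent (lastOf a l) b) →
                          map proj₁ (steps (closedWalk lk e)) ≡ a ∷ l
    closedWalk-vertices [-]      e = refl
    closedWalk-vertices (_ ∷ lk) e = cong (_ ∷_) (closedWalk-vertices lk e)

    consecutive⊆steps : ∀ {a l} (lk : Linked Adjacent (a ∷ l)) (e : Adjacent (lastOf a l) b) →
                        consecutive a l ⊆ steps (closedWalk lk e)
    consecutive⊆steps (_ ∷ lk) e (here refl) = here refl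
    consecutive⊆steps (_ ∷ lk) e (there pq∈) = there (consecutive⊆steps lk e pq∈)

    closing∈steps : ∀ {a l} (lk : Linked Adjacent (a ∷ l)) (e : Adjacent (lastOf a l) b) →
                    (lastOf a l , b) ∈ steps (closedWalk lk e)
    closing∈steps [-]      e = here refl
    closing∈steps (_ ∷ lk) e = there (closing∈steps lk e)

  step⇒adjacent : ∀ {a b p q} (w : Walk a b) → (p , q) ∈ steps w → Adjacent p q
  step⇒adjacent (e ◅ _) (here refl) = e
  step⇒adjacent (_ ◅ w) (there pq∈) = step⇒adjacent w pq∈

  -- An edge traversed back and forth also qualifies, hence the bound `2 ≤ length rest` when passing
  -- to a circuit.
  record Cycle : Set where
    constructor cycle
    field
      {first}  : V
      {rest}   : List V
      distinct : Unique (first ∷ rest)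
      linked   : Linked Adjacent (first ∷ rest)
      closes   : Adjacent (lastOf first rest) first

    support : List V
    support = first ∷ rest

  module _ (Z : Cycle) where
    open Cycle Z

    toCircuit : 2 ≤ length rest → Circuit
    toCircuit 2≤ = record
      { walk     = closedWalk linked closes
      ; 3≤size   = subst (3 ≤_) (sym (trans (sym (List.length-map proj₁ (steps w)))
                     (cong length (closedWalk-vertices linked closes)))) (s≤s 2≤)
      ; distinct = subst Unique (sym (closedWalk-vertices linked closes)) distinct
      }
      where w = closedWalk linked closes

    -- Each vertex has two distinct neighbours along the cycle; an edge off the cycle would give it
    -- a third.
    spanning⇒wholeGraph : (2≤ : 2 ≤ length rest) → (∀ v → v ∈ support) → (∀ v → degree v ≤ 2) →
                          toCircuit 2≤ IsWholeGraph
    spanning⇒wholeGraph 2≤ spans degree≤2 =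
      (λ v → subst (v ∈_) (sym (closedWalk-vertices linked closes)) (spans v)) , covers
      where
      E = edges (toCircuit 2≤)

      cycle-neighbours : ∀ {h l u} → Unique (h ∷ l) →
        ∀ (lk : Linked Adjacent (h ∷ l)) (e : Adjacent (lastOf h l) h) → 2 ≤ length l → u ∈ h ∷ l →
        ∃₂ λ p s → p ≢ s × (p , u) ∈ steps (closedWalk lk e) × (u , s) ∈ steps (closedWalk lk e)
      cycle-neighbours {l = _ ∷ []} _ _ _ (s≤s ()) _
      cycle-neighbours {l = b ∷ c ∷ l} (_ ∷ b∉ ∷ _) (hb ∷ lk) e _ (here refl) =
        lastOf c l , b , (λ { refl → All.lookup b∉ (lastOf∈ c l) refl }) ,
        closing∈steps (hb ∷ lk) e , here refl
      cycle-neighbours {l = b ∷ c ∷ l} uni@(h∉ ∷ _) lk e _ (there u∈) with interior uni u∈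
      ... | inj₂ (p , s , p≢s , p∈ , s∈) =
        p , s , p≢s , consecutive⊆steps lk e p∈ , consecutive⊆steps lk e s∈
      ... | inj₁ refl = let p , p∈ , e′ = before-last b c l in
        p , _ , (λ { refl → All.lookup h∉ p∈ refl }) ,
        consecutive⊆steps lk e (there e′) , closing∈steps lk e

      covers : ∀ u v → Adjacent u v → (u , v) ∈ E ⊎ (v , u) ∈ E
      covers u v uv with cycle-neighbours distinct linked closes 2≤ (spans u)
      ... | p , s , p≢s , pu∈ , us∈ with v Fin.≟ p | v Fin.≟ s
      ...   | yes refl | _        = inj₂ pu∈
      ...   | no _     | yes refl = inj₁ us∈
      ...   | no v≢p   | no v≢s   = contradiction
        (ℕ.≤-trans (unique-⊆⇒length-≤ {ys = neighbours u}
                     ((v≢p ∷ v≢s ∷ []) ∷ (p≢s ∷ []) ∷ [] ∷ [])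
                     λ { (here refl)                 → ∈-neighbours⁺ uv
                       ; (there (here refl))         → ∈-neighbours⁺ (adj-sym (step⇒adjacent w pu∈))
                       ; (there (there (here refl))) → ∈-neighbours⁺ (step⇒adjacent w us∈) })
                   (degree≤2 u))
        ℕ.1+n≰n
        where w = closedWalk linked closes

  -- Connections along paths and maximal paths

  linked-joinedToHead : ∀ {U a l c} → Linked Adjacent (a ∷ l) → All U (a ∷ l) → c ∈ a ∷ l → JoinedIn U c a
  linked-joinedToHead _         _              (here refl) = ε
  linked-joinedToHead (ab ∷ lk) (Ua ∷ Ub ∷ Ul) (there c∈)  =
    linked-joinedToHead lk (Ub ∷ Ul) c∈ ◅◅ (adj-sym ab , Ub , Ua) ◅ ε

  linked-joined : ∀ {U l c d} → Linked Adjacent l → All U l → c ∈ l → d ∈ l → JoinedIn U c d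
  linked-joined {l = _ ∷ _} lk Ul c∈ d∈ =
    linked-joinedToHead lk Ul c∈ ◅◅ joinedIn-sym (linked-joinedToHead lk Ul d∈)

  connected⇒spans : ∀ {l a} → Connected → a ∈ l → (∀ {u v} → u ∈ l → Adjacent u v → v ∈ l) → ∀ v → v ∈ l
  connected⇒spans {l} {a} connected a∈ closed v = along (connected a v) a∈
    where
    along : ∀ {b} → Walk b v → b ∈ l → v ∈ l
    along ε         b∈ = b∈
    along (bc ◅ w)  b∈ = along w (closed b∈ bc)

  -- Paths grow at the head of the list, so `h` is the end that cannot be extended.
  Maximal : List V → Set
  Maximal l = ∃₂ λ h r →
    l ≡ h ∷ r × Unique (h ∷ r) × Linked Adjacent (h ∷ r) × (∀ u → Adjacent h u → u ∈ r)

  -- The initial path survives as the tail of the result, which keeps the cherry at the far end from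
  -- the new head.
  maximalPath : ∀ h r → Unique (h ∷ r) → Linked Adjacent (h ∷ r) → ∃ λ Q → Maximal (Q ++ h ∷ r)
  maximalPath h r u lk = unique-induction Extendable step (h ∷ r) u h r refl lk
    where
    Extendable : List V → Set
    Extendable T = ∀ h r → T ≡ h ∷ r → Linked Adjacent T → ∃ λ Q → Maximal (Q ++ T)

    step : ∀ T → Unique T → (∀ w → w ∉ T → Extendable (w ∷ T)) → Extendable T
    step _ uT ih h r refl lk with Fin.any? (λ w → adjacent? h w ×-dec ¬? (w ∈? h ∷ r))
    ... | yes (w , hw , w∉) = let Q , max = ih w w∉ w (h ∷ r) refl (adj-sym hw ∷ lk) in
      Q ++ [ w ] , subst Maximal (sym (List.++-assoc Q [ w ] (h ∷ r))) max
    ... | no none = [] , h , r , refl , uT , lk , λ u hu → inTail hu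
      (decidable-stable (u ∈? h ∷ r) λ u∉ → none (u , hu , u∉))
      where
      inTail : ∀ {u} → Adjacent h u → u ∈ h ∷ r → u ∈ r
      inTail hu (here refl) = contradiction refl (adj⇒≢ hu)
      inTail hu (there u∈)  = u∈

  maximal⇒cycle : ∀ {l} → Maximal l → (∀ v → 2 ≤ degree v) →
    ∃ λ (Z : Cycle) → let open Cycle Z in
    support ⊆ l × (∀ u → Adjacent first u → u ∈ rest) × 2 ≤ length rest
  maximal⇒cycle (h , r , refl , u , lk , nbrs) 2≤degree
    with ∃∉ Fin._≟_ {ys = []} (neighbours-unique h) (ℕ.<⇒≤ (2≤degree h))
  ... | x , x∈ , _
    -- `z` is the neighbour of `h` farthest along the path, so discarding the part `D` beyond it
    -- loses no neighbour of `h`.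
    with lastSatisfying (adjacent? h) (lose (nbrs x (∈-neighbours⁻ x∈)) (∈-neighbours⁻ x∈))
  ...   | A , z , D , refl , hz , beyond =
    cycle (unique-++⁻ˡ (h ∷ A ++ [ z ]) (subst Unique split u))
          (linked-++⁻ˡ (h ∷ A ++ [ z ]) (subst (Linked Adjacent) split lk))
          (subst (λ b → Adjacent b h) (sym (lastOf-++ h A)) (adj-sym hz)) ,
    (λ {c} c∈ → subst (c ∈_) (sym split) (∈-++⁺ˡ c∈)) ,
    nbrs′ ,
    ℕ.≤-trans (2≤degree h) (unique-⊆⇒length-≤ (neighbours-unique h) λ y∈ → nbrs′ _ (∈-neighbours⁻ y∈))
    where
    split : h ∷ A ++ z ∷ D ≡ (h ∷ A ++ [ z ]) ++ D
    split = sym (List.++-assoc (h ∷ A) [ z ] D)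

    nbrs′ : ∀ y → Adjacent h y → y ∈ A ++ [ z ]
    nbrs′ y hy with ∈-++⁻ (A ++ [ z ]) (subst (y ∈_) (sym (List.++-assoc A [ z ] D)) (nbrs y hy))
    ... | inj₁ y∈ = y∈
    ... | inj₂ y∈ = contradiction hy (All.lookup beyond y∈)

  -- A cycle minus `s` is a path starting at `t`. The vertices listed before `s` reach `t` through
  -- the head `h` and the closing edge.
  cycle-joined : ∀ {U h l} as {s t bs} → h ∷ l ≡ as ++ s ∷ t ∷ bs →
    Unique (h ∷ l) → Linked Adjacent (h ∷ l) → Adjacent (lastOf h l) h →
    (∀ c → c ∈ h ∷ l → c ≢ s → U c) → ∀ c → c ∈ h ∷ l → c ≢ s → JoinedIn U c t
  cycle-joined {U} [] refl (s∉ ∷ _) (_ ∷ lk) _ inU c (here refl) c≢s = contradiction refl c≢s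
  cycle-joined {U} [] refl (s∉ ∷ _) (_ ∷ lk) _ inU c (there c∈)  c≢s = linked-joinedToHead lk
    (All.tabulate λ {d} d∈ → inU d (there d∈) λ { refl → All.lookup s∉ d∈ refl }) c∈
  cycle-joined {U} {h} (_ ∷ as) {s} {t} {bs} refl u lk closes inU c c∈ c≢s = fromPart (∈-++⁻ (h ∷ as) c∈)
    where
    U-as : All U (h ∷ as)
    U-as = All.tabulate λ {d} d∈ → inU d (∈-++⁺ˡ d∈) (unique-++⁻-disjoint (h ∷ as) u d∈ (here refl))

    U-t : All U (t ∷ bs)
    U-t = All.tabulate λ {d} d∈ → inU d (∈-++⁺ʳ (h ∷ as) (there d∈))
      λ { refl → Unique.Unique[x∷xs]⇒x∉xs (unique-++⁻ʳ (h ∷ as) u) d∈ }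

    toT : ∀ {d} → d ∈ t ∷ bs → JoinedIn U d t
    toT = linked-joinedToHead (linked-++⁻ʳ [ s ] (linked-++⁻ʳ (h ∷ as) lk)) U-t

    last~h : Adjacent (lastOf t bs) h
    last~h = subst (λ b → Adjacent b h) (lastOf-++ h as) closes

    fromPart : c ∈ h ∷ as ⊎ c ∈ s ∷ t ∷ bs → JoinedIn U c t
    fromPart (inj₁ c∈as)         = linked-joinedToHead (linked-++⁻ˡ (h ∷ as) lk) U-as c∈as ◅◅
      (adj-sym last~h , All.head U-as , All.lookup U-t (lastOf∈ t bs)) ◅ toT (lastOf∈ t bs)
    fromPart (inj₂ (here c≡s))   = contradiction c≡s c≢s
    fromPart (inj₂ (there c∈t))  = toT c∈t

  Leaves : List V → V → Set
  Leaves l t = ∃ λ u → u ∉ l × Adjacent t u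

  leaves? : ∀ l → Decidable (Leaves l)
  leaves? l t = Fin.any? λ u → ¬? (u ∈? l) ×-dec adjacent? t u

  -- Colouring with n colours, case by case

  module _ (n : ℕ) (degree≤n : ∀ v → degree v ≤ n) where

    deficient⇒colourable : Connected → ∀ v → degree v < n → Colourable G n
    -- Nothing is precoloured, so `const (+ 0)` is a placeholder.
    deficient⇒colourable connected v d = colourable-towards n degree≤n {D = λ _ → ⊥} {φ = const (+ 0)}
      (λ _ → no λ ()) ((λ _ ()) , λ _ _ _ ()) v
      (λ u _ → Star.map (λ uv → uv , (λ ()) , λ ()) (connected u v))
      (λ _ _ → deficient d)

    leaving⇒colourable : Connected → (Z : Cycle) → let open Cycle Z in
      (∀ u → Adjacent first u → u ∈ rest) → Any (Leaves support) rest → Colourable G n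
    leaving⇒colourable connected (cycle {h} {l} uni lk closes) nbrs leaving
      -- No edge leaves the cycle at `h`, but one does at a later vertex, so a transition from `s`
      -- to `t` occurs in between.
      with crossing (leaves? (h ∷ l)) {h} (λ (u , u∉ , hu) → u∉ (there (nbrs u hu))) leaving
    ... | as , s , t , bs , eq , s-inside , u , u∉ , tu =
      colourable-agreeing n degree≤n D? col₂ t joined s u s≢u (inj₂ refl) (inj₁ u∉) ts tu agree
      where
      C = h ∷ l

      D : V → Set
      D v = v ∉ C ⊎ v ≡ s

      D? : Decidable D
      D? v = ¬? (v ∈? C) ⊎-dec (v Fin.≟ s)

      s∈ : s ∈ C
      s∈ = subst (s ∈_) (sym eq) (∈-++⁺ʳ as (here refl))

      s≢u : s ≢ u
      s≢u refl = u∉ s∈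

      ts : Adjacent t s
      ts with linked-++⁻ʳ as (subst (Linked Adjacent) eq lk)
      ... | st ∷ _ = adj-sym st

      outside : ∃ λ ψ → (∀ {v} → ⊥ → ψ v ≡ + 0) × ColouringOn n (_∉ C) ψ
      outside = greedy n degree≤n {D = λ _ → ⊥} {φ = const (+ 0)}
        (λ _ → no λ ()) ((λ _ ()) , λ _ _ _ ()) C uni
        (λ v _ → h , here refl , Star.map (λ vw → vw , (λ ()) , λ ()) (connected v h))

      φ₁ = proj₁ outside
      col₁ = proj₂ (proj₂ outside)

      -- Solves `sgn t s • z ≡ sgn t u • φ₁ u`, so that `s` and `u` forbid the same colour at `t`.
      z : ℤ
      z = sgn t s • sgn t u • φ₁ u

      φ₂ = recoloured n {_∉ C} {φ₁} s z

      col₂ : ColouringOn n D φ₂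
      col₂ = recolour n s z col₁
        (M-• n (sgn t s) (sgn t u • φ₁ u) (M-• n (sgn t u) (φ₁ u) (proj₁ col₁ u u∉)))
        -- All neighbours of `s` lie on the still uncoloured cycle, so any colour of `M n` is
        -- allowed at `s`.
        (λ v sv v∉ → contradiction (v , v∉ , sv) s-inside)

      agree : forbidden n φ₂ t s ≡ forbidden n φ₂ t u
      agree = trans (cong (sgn t s •_) (recoloured-new n {_∉ C} {φ₁} s z))
        (trans (•-involutive (sgn t s) _)
        (cong (sgn t u •_) (sym (recoloured-old n {_∉ C} {φ₁} s z (s≢u ∘ sym)))))

      joined : ∀ v → ¬ D v → JoinedIn (¬_ ∘ D) v t
      joined v ¬Dv = cycle-joined as eq uni lk closes
        (λ { c c∈ c≢s (inj₁ c∉) → c∉ c∈ ; c c∈ c≢s (inj₂ c≡s) → c≢s c≡s })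
        v (decidable-stable (v ∈? C) (¬Dv ∘ inj₁)) (¬Dv ∘ inj₂)

    -- After deleting `x` and `y`, the path Q remains connected, and a third neighbour `w` of `v`
    -- attaches `v` to it.
    spanning⇒colourable : ∀ Q {v x y} → Cherry v x y →
      Unique (Q ++ y ∷ v ∷ x ∷ []) → Linked Adjacent (Q ++ y ∷ v ∷ x ∷ []) →
      (∀ u → u ∈ Q ++ y ∷ v ∷ x ∷ []) → 3 ≤ degree v → Colourable G n
    spanning⇒colourable Q {v} {x} {y} (x≢y , s , t , vx , vy , xy) uni lk spans 3≤
      with ∃∉ Fin._≟_ {ys = x ∷ y ∷ []} (neighbours-unique v) 3≤
    ... | w , w∈N , w∉ =
      colourable-agreeing n degree≤n D? col v joined x y x≢y (inj₁ refl) (inj₂ refl) (s , vx) (t , vy)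
        (trans (forbids-1 vx φx) (sym (forbids-1 vy φy)))
      where
      D : V → Set
      D u = u ≡ x ⊎ u ≡ y

      D? : Decidable D
      D? u = (u Fin.≟ x) ⊎-dec (u Fin.≟ y)

      -- Colour s at `x` and t at `y`, as s s = t t = + makes both forbid the colour 1 at `v`. The
      -- default `t` matters only at `y`.
      η : V → Sign
      η = Vector.updateAt (const t) x (const s)

      φ : V → ℤ
      φ u = η u ◃ 1

      φx : φ x ≡ s ◃ 1
      φx = cong (_◃ 1) (Vector.updateAt-updates x (const t))

      φy : φ y ≡ t ◃ 1
      φy = cong (_◃ 1) (Vector.updateAt-minimal y x (const t) (x≢y ∘ sym))

      forbids-1 : ∀ {u r} → label v u ≡ just r → φ u ≡ r ◃ 1 → forbidden n φ v u ≡ + 1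
      forbids-1 {r = r} e φu = trans (cong₂ _•_ (label⇒sgn e) φu)
        (trans (◃1-* r r) (cong (_◃ 1) (Sign.s*s≡+ r)))

      2≤n : 2 ≤ n
      2≤n = ℕ.≤-trans (ℕ.<⇒≤ 3≤) (degree≤n v)

      xy-proper : ∀ r → label x y ≡ just r → φ x ≢ r • φ y
      -- A conflict means s = r t, hence r = s t, the one label that a cherry rules out.
      xy-proper r e eq = xy (trans e (cong just (begin
        r                         ≡⟨ Sign.*-identityʳ r ⟨
        r Sign.* Sign.+           ≡⟨ cong (r Sign.*_) (Sign.s*s≡+ t) ⟨
        r Sign.* (t Sign.* t)     ≡⟨ Sign.*-assoc r t t ⟨
        (r Sign.* t) Sign.* t     ≡⟨ cong (Sign._* t) (ℤ.sign-cong {1} {1} {s} {r Sign.* t} eq′) ⟨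
        s Sign.* t                ∎)))
        where
        open ≡-Reasoning
        eq′ : s ◃ 1 ≡ (r Sign.* t) ◃ 1
        eq′ = trans (sym φx) (trans eq (trans (cong (r •_) φy) (◃1-* r t)))

      col : ColouringOn n D φ
      col = (λ u _ → M-◃1 n (η u) 2≤n) , λ where
        u w r (inj₁ refl) (inj₁ refl) e _ → adj⇒≢ (r , e) refl
        u w r (inj₁ refl) (inj₂ refl) e → xy-proper r e
        u w r (inj₂ refl) (inj₁ refl) e eq → xy-proper r (trans (label-sym x y) e)
          (sym (trans (cong (r •_) eq) (•-involutive r (φ x))))
        u w r (inj₂ refl) (inj₂ refl) e _ → adj⇒≢ (r , e) refl

      ¬D-Q : All (¬_ ∘ D) Q
      ¬D-Q = All.tabulate λ where
        u∈ (inj₁ refl) → unique-++⁻-disjoint Q uni u∈ (there (there (here refl))) refl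
        u∈ (inj₂ refl) → unique-++⁻-disjoint Q uni u∈ (here refl) refl

      vw : Adjacent v w
      vw = ∈-neighbours⁻ w∈N

      located : ∀ u → ¬ D u → u ∈ Q ⊎ u ≡ v
      located u ¬Du with ∈-++⁻ Q (spans u)
      ... | inj₁ u∈                          = inj₁ u∈
      ... | inj₂ (here u≡y)                  = contradiction (inj₂ u≡y) ¬Du
      ... | inj₂ (there (here u≡v))          = inj₂ u≡v
      ... | inj₂ (there (there (here u≡x)))  = contradiction (inj₁ u≡x) ¬Du

      ¬Dw : ¬ D w
      ¬Dw (inj₁ w≡x) = w∉ (here w≡x)
      ¬Dw (inj₂ w≡y) = w∉ (there (here w≡y))

      ¬Dv : ¬ D v
      ¬Dv (inj₁ v≡x) = adj⇒≢ (s , vx) v≡x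
      ¬Dv (inj₂ v≡y) = adj⇒≢ (t , vy) v≡y

      w∈Q : w ∈ Q
      w∈Q with located w ¬Dw
      ... | inj₁ w∈   = w∈
      ... | inj₂ refl = contradiction refl (adj⇒≢ vw)

      joined : ∀ u → ¬ D u → JoinedIn (¬_ ∘ D) u v
      joined u ¬Du with located u ¬Du
      ... | inj₂ refl = ε
      ... | inj₁ u∈   = linked-joined (linked-++⁻ˡ Q lk) ¬D-Q u∈ w∈Q ◅◅ (adj-sym vw , ¬Dw , ¬Dv) ◅ ε

  -- Regular graphs and the conclusion

  degree≤Δ : ∀ v → degree v ≤ Δ
  degree≤Δ v = All.lookup (xs≤max 0 (map degree (allFin order))) (∈-map⁺ degree (∈-allFin v))

  cherry⇒2≤degree : ∀ {v x y} → Cherry v x y → 2 ≤ degree v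
  cherry⇒2≤degree {v} (x≢y , s , t , vx , vy , _) =
    unique-⊆⇒length-≤ {ys = neighbours v} ((x≢y ∷ []) ∷ [] ∷ []) λ where
      (here refl)         → ∈-neighbours⁺ (s , vx)
      (there (here refl)) → ∈-neighbours⁺ (t , vy)

  regular⇒colourable : ∀ n → Connected → (∀ v → degree v ≡ n) → (∃ λ v → ∃₂ (Cherry v)) →
    ¬ (IsOddCircuit × Balanced) → ¬ (IsEvenCircuit × ¬ Balanced) → Colourable G n
  regular⇒colourable n connected regular (v , x , y , ch@(x≢y , s , t , vx , vy , _)) notOdd notEven
    with maximalPath y (v ∷ x ∷ [])
           ((adj⇒≢ (adj-sym (t , vy)) ∷ (x≢y ∘ sym) ∷ []) ∷ (adj⇒≢ (s , vx) ∷ []) ∷ [] ∷ [])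
           (adj-sym (t , vy) ∷ (s , vx) ∷ [-])
  ... | Q , max@(h , r , eq , uni , lk , _)
    with maximal⇒cycle max (λ u → subst (2 ≤_) (trans (regular v) (sym (regular u))) (cherry⇒2≤degree ch))
  ...   | Z , Z⊆ , nbrs , 2≤rest with Any.any? (leaves? (Cycle.support Z)) (Cycle.rest Z)
  ...     | yes leaving = leaving⇒colourable n (ℕ.≤-reflexive ∘ regular) connected Z nbrs leaving
  ...     | no none = byDegree (ℕ.m≤n⇒m<n∨m≡n 2≤n)
    where
    degree≤n : ∀ u → degree u ≤ n
    degree≤n = ℕ.≤-reflexive ∘ regular

    2≤n : 2 ≤ n
    2≤n = subst (2 ≤_) (regular v) (cherry⇒2≤degree ch)

    closed : ∀ {u w} → u ∈ Cycle.support Z → Adjacent u w → w ∈ Cycle.support Z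
    closed (here refl) uw = there (nbrs _ uw)
    closed (there u∈)  uw = decidable-stable (_ ∈? Cycle.support Z) λ w∉ → none (lose u∈ (_ , w∉ , uw))

    spans : ∀ u → u ∈ Cycle.support Z
    spans = connected⇒spans connected (here refl) closed

    byDegree : 2 < n ⊎ 2 ≡ n → Colourable G n
    -- The spanning cycle lies on the maximal path, so that path spans as well.
    byDegree (inj₁ 3≤n) = spanning⇒colourable n degree≤n Q ch
      (subst Unique (sym eq) uni) (subst (Linked Adjacent) (sym eq) lk) (λ u → Z⊆ (spans u))
      (subst (3 ≤_) (sym (regular v)) 3≤n)
    byDegree (inj₂ refl) = whole-circuit-colourable 2 ℕ.≤-refl (toCircuit Z 2≤rest)
      (spanning⇒wholeGraph Z 2≤rest spans degree≤n) notOdd notEven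

theorem3p1 : (G : SimpleSignedGraph) →
    let open SimpleSignedGraph G in
    Connected →
    ¬ (Complete × Balanced) →
    ¬ (IsOddCircuit × Balanced) →
    ¬ (IsEvenCircuit × ¬ Balanced) →
    χ G ≤ Δ
theorem3p1 G connected notComplete notOdd notEven
  with Fin.any? (λ v → Fin.any? λ x → Fin.any? λ y → cherry? G v x y)
... | no none = contradiction
  (cherryless⇒complete G cherryless connected , cherryless⇒balanced G cherryless) notComplete
  where
  cherryless : ∀ v x y → ¬ Cherry G v x y
  cherryless v x y ch = none (v , x , y , ch)
... | yes ch@(v , _ , _ , vxy) = proj₂ (proj₂ (proj₂ (chromaticNumber G))) Δ 1≤Δ colourable
  where
  open SimpleSignedGraph G

  -- The minimality of `χ` ranges over positive numbers of colours only; the centre of the cherry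
  -- has degree at least 2.
  1≤Δ : 1 ≤ Δ
  1≤Δ = ℕ.≤-trans (ℕ.<⇒≤ (cherry⇒2≤degree G vxy)) (degree≤Δ G v)

  colourable : Colourable G Δ
  colourable with Fin.any? (λ u → degree u ℕ.<? Δ)
  ... | yes (u , d) = deficient⇒colourable G Δ (degree≤Δ G) connected u d
  ... | no none     = regular⇒colourable G Δ connected
    (λ u → ℕ.≤-antisym (degree≤Δ G u) (ℕ.≮⇒≥ λ d → none (u , d))) ch notOdd notEven
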